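{- Let $T$ be a finite tree. Then $\tilde{r}_2(T)\le 2\,\tilde{\alpha}(T)$.
   Context: All graphs are finite, simple and undirected. For a graph $G$, a set $U\subseteq V(G)$ is $P_3$-convex if every vertex of $G$ not in $U$ has at most one neighbour in $U$. The convex hull $H_G(S)$ of $S\subseteq V(G)$ is the intersection of all $P_3$-convex sets containing $S$; for a multi-set its hull is that of its underlying set. A multi-set $R$ of vertices is $2$-anti-Radon if there is no partition of $R$ (as a multi-set) into two multi-sets $R_1,R_2$ with $H_G(R_1)\cap H_G(R_2)\neq\emptyset$; $\tilde{r}_2(G)$ is the maximum size of a $2$-anti-Radon multi-set of vertices of $G$ (such a multi-set necessarily has no repeated elements). A set $A\subseteq V(G)$ is free if every vertex of $G$ has at most one neighbour in $A$, and $\tilde{\alpha}(G)$ is the maximum size of a free set in $G$. -}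

module Defs where

open import Data.Nat using (ℕ; _≤_; _*_; _+_)
open import Data.Fin using (Fin)
open import Data.Fin.Subset using (Subset; _∈_; _∉_; ∣_∣)
open import Data.Bool using (Bool; true; false)
open import Data.List using (List; []; _∷_; length; lookup; last)
open import Data.List.Relation.Unary.Linked using (Linked)
open import Data.List.Relation.Unary.Unique.Propositional using (Unique)
open import Data.Product using (Σ; ∃; _×_; _,_)
open import Data.Maybe using (just)
open import Data.Empty using (⊥)
open import Relation.Nullary using (¬_)
open import Relation.Binary.PropositionalEquality using (_≡_)

record Graph (n : ℕ) : Set₁ where
  field
    Adj   : Fin n → Fin n → Set
    sym   : ∀ {u v} → Adj u v → Adj v u
    irrefl : ∀ {u} → ¬ Adj u u
open Graph public

data Walk {n : ℕ} (G : Graph n) : Fin n → Fin n → Set where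
  here : ∀ {u} → Walk G u u
  step : ∀ {u w v} → Adj G u w → Walk G w v → Walk G u v

Connected : ∀ {n} → Graph n → Set
Connected {n} G = ∀ (u v : Fin n) → Walk G u v

record Cycle {n : ℕ} (G : Graph n) : Set where
  field
    v₀ v₁ v₂ : Fin n
    rest     : List (Fin n)
    distinct : Unique (v₀ ∷ v₁ ∷ v₂ ∷ rest)
    linked   : Linked (Adj G) (v₀ ∷ v₁ ∷ v₂ ∷ rest)
    closing  : ∀ {x} → last (v₂ ∷ rest) ≡ just x → Adj G x v₀

Acyclic : ∀ {n} → Graph n → Set
Acyclic G = ¬ Cycle G

IsTree : ∀ {n} → Graph n → Set
IsTree G = Connected G × Acyclic G

AtMostOneNbrIn : ∀ {n} → Graph n → Subset n → Fin n → Set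
AtMostOneNbrIn G U v =
  ∀ a b → Adj G v a → Adj G v b → a ∈ U → b ∈ U → a ≡ b

P3Convex : ∀ {n} → Graph n → Subset n → Set
P3Convex {n} G U = ∀ (v : Fin n) → v ∉ U → AtMostOneNbrIn G U v

InHull : ∀ {n} → Graph n → (Fin n → Set) → Fin n → Set
InHull {n} G S v =
  ∀ (U : Subset n) → P3Convex G U → (∀ x → S x → x ∈ U) → v ∈ U

-- Multi-sets of vertices are lists; a partition of a multiset R into two
-- multisets R₁, R₂ is a colouring of the positions of R by Bool.
-- Part R f b x : x occurs (as an element) in the part coloured b.
Part : ∀ {n} (R : List (Fin n)) → (Fin (length R) → Bool) → Bool → Fin n → Set
Part R f b x = ∃ λ i → f i ≡ b × lookup R i ≡ x

AntiRadon2 : ∀ {n} → Graph n → List (Fin n) → Set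
AntiRadon2 {n} G R =
  ∀ (f : Fin (length R) → Bool) →
    ¬ (Σ (Fin n) λ v → InHull G (Part R f true) v × InHull G (Part R f false) v)

Free : ∀ {n} → Graph n → Subset n → Set
Free {n} G A = ∀ (v : Fin n) → AtMostOneNbrIn G A v

{-# OPTIONS --safe #-}
module Submission where

-- Root the tree. Going upwards from the leaves, put a vertex into D whenever one
-- of its children has no child in D, and let A contain one such child for every
-- vertex of D, together with the root if it has no child in D. Then A is free:
-- two neighbours of x in A would be two children of x, or the parent of x and a
-- child of x; in the latter case x ∈ D, so the parent of x has a child in D.
--
-- To bound |R| by 2|A|, compare |R| with 2|D| in each branch. A surplus makes the part of R in the branch generate its root, and if
-- four disjoint parts of R each generate a neighbour of v, then splitting them
-- two and two puts v into both hulls. Three such parts below v still prevent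
-- the rest of R from generating the parent of v. Propagating
-- these statements upwards leaves a surplus of at most one at the root, and only
-- if the root has no child in D, in which case the root itself belongs to A.

open import Defs
open import Data.Nat using (ℕ; zero; suc; _≤_; _*_; _+_; z≤n; s≤s; s≤s⁻¹)
open import Data.Nat.Properties
  using (≤-trans; ≤-reflexive; +-mono-≤; n≤1+n; m≤n⇒m≤1+n; *-distribˡ-+; *-monoʳ-≤)
open import Data.Nat.Tactic.RingSolver using (solve-∀)
open import Data.Fin using (Fin; zero; suc; _≟_)
open import Data.Fin.Properties using (injective⇒≤)
open import Data.Fin.Subset using (Subset; ∣_∣; ⁅_⁆; _∪_; _-_) renaming (_∈_ to _∈ₛ_; ⊥ to ∅)
open import Data.Fin.Subset.Properties
  using (∉⊥; x∈⁅x⁆; x∈⁅y⁆⇒x≡y; x∈p∪q⁺; x∈p∪q⁻; p⊆q⇒∣p∣≤∣q∣; x∈p⇒∣p-x∣<∣p∣; x∈p∧x≢y⇒x∈p-y)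
  renaming (_∈?_ to _∈ₛ?_)
open import Data.Bool using (Bool; true; false; not; _∨_; if_then_else_)
open import Data.List using (List; []; _∷_; _++_; length; lookup; last; filter; allFin)
open import Data.List.Properties using (length-++; filter-++)
open import Data.List.Membership.Propositional using (_∈_; _∉_)
open import Data.List.Membership.Propositional.Properties using (∈-++⁺ˡ; ∈-++⁺ʳ; ∈-++⁻; ∈-lookup; ∈-allFin; ∈-filter⁺)
open import Data.List.Relation.Binary.Subset.Propositional using (_⊆_)
open import Data.List.Relation.Binary.Disjoint.Propositional using (Disjoint)
open import Data.List.Relation.Unary.Any using (here; there; index)
open import Data.List.Relation.Unary.Any.Properties using (lookup-index)
open import Data.List.Relation.Unary.All as All using (All; []; _∷_)
open import Data.List.Relation.Unary.AllPairs using (AllPairs; []; _∷_)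
open import Data.List.Relation.Unary.Linked using (Linked; [-]; _∷_)
open import Data.List.Relation.Unary.Unique.Propositional using (Unique)
import Data.List.Relation.Unary.Unique.Propositional.Properties as Unique
open import Data.Maybe using (just)
open import Data.Product using (Σ; ∃; _×_; _,_; proj₁; proj₂)
open import Data.Sum using (_⊎_; inj₁; inj₂; [_,_]′; map₂)
open import Data.Empty using (⊥; ⊥-elim)
open import Function using (_∘_)
open import Relation.Nullary using (¬_; Dec; yes; no; does)
open import Relation.Nullary.Decidable using (dec-true; dec-false)
open import Relation.Binary.PropositionalEquality using (_≡_; refl; cong; subst; trans)
import Relation.Binary.PropositionalEquality as ≡

-- Lists of vertices as subsets

module _ {n : ℕ} where

  open import Data.List.Membership.DecPropositional (_≟_ {n}) using (_∈?_) public

  fromList : List (Fin n) → Subset n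
  fromList []       = ∅
  fromList (x ∷ xs) = ⁅ x ⁆ ∪ fromList xs

  ∈-fromList⁻ : ∀ {x} xs → x ∈ₛ fromList xs → x ∈ xs
  ∈-fromList⁻ []       x∈ = ⊥-elim (∉⊥ x∈)
  ∈-fromList⁻ (y ∷ xs) x∈ with x∈p∪q⁻ ⁅ y ⁆ (fromList xs) x∈
  ... | inj₁ x∈y  = here (x∈⁅y⁆⇒x≡y y x∈y)
  ... | inj₂ x∈xs = there (∈-fromList⁻ xs x∈xs)

  length≤∣fromList∣ : ∀ {xs} → Unique xs → length xs ≤ ∣ fromList xs ∣
  length≤∣fromList∣ []                   = z≤n
  length≤∣fromList∣ {x ∷ xs} (x∉xs ∷ xs!) =
    ≤-trans (s≤s (≤-trans (length≤∣fromList∣ xs!) (p⊆q⇒∣p∣≤∣q∣ without)))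
            (x∈p⇒∣p-x∣<∣p∣ (x∈p∪q⁺ (inj₁ (x∈⁅x⁆ x))))
    where
    without : ∀ {y} → y ∈ₛ fromList xs → y ∈ₛ (⁅ x ⁆ ∪ fromList xs) - x
    without y∈ = x∈p∧x≢y⇒x∈p-y (x∈p∪q⁺ (inj₂ y∈))
      λ { refl → All.lookup x∉xs (∈-fromList⁻ xs y∈) refl }

module _ {n : ℕ} (G : Graph n) where

  private V = Fin n

  AtMostOneNbrInList : List V → V → Set
  AtMostOneNbrInList A x = ∀ {a b} → Adj G x a → Adj G x b → a ∈ A → b ∈ A → a ≡ b

  -- Paths in an acyclic graph

  data Path : V → V → List V → Set where
    stop : ∀ {a} → Path a a (a ∷ [])
    step : ∀ {a w b p} → Adj G a w → Path w b p → a ∉ p → Path a b (a ∷ p)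

  join : ∀ {a b c d p q} → Path a b p → Adj G b c → Path c d q → Disjoint p q → Path a d (p ++ q)
  join stop            bc Q p#q = step bc Q λ a∈q → p#q (here refl , a∈q)
  join (step e P a∉p)  bc Q p#q = step e (join P bc Q (λ (x∈p , x∈q) → p#q (there x∈p , x∈q)))
    λ a∈ → [ a∉p , (λ a∈q → p#q (here refl , a∈q)) ]′ (∈-++⁻ _ a∈)

  path-unique : ∀ {a b p} → Path a b p → Unique p
  path-unique stop           = [] ∷ []
  path-unique (step _ P a∉p) = All.tabulate (λ x∈p a≡x → a∉p (subst (_∈ _) (≡.sym a≡x) x∈p)) ∷ path-unique P

  path-linked : ∀ {a b p} → Path a b p → Linked (Adj G) p
  path-linked stop                        = [-]
  path-linked (step e stop _)             = e ∷ [-]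
  path-linked (step e P@(step _ _ _) _)   = e ∷ path-linked P

  path-last : ∀ {a b p} → Path a b p → last p ≡ just b
  path-last stop                      = refl
  path-last (step _ stop _)           = refl
  path-last (step _ P@(step _ _ _) _) = path-last P

  -- Otherwise the path and the two edges at `x` would close up to a cycle. Matching one step into
  -- the path exposes the third vertex that `Cycle` displays, hence the separate triangle clause.
  acyclic⇒nbrs-joined-avoiding-equal : Acyclic G → ∀ {x a b p} →
    Adj G x a → Adj G x b → Path a b p → x ∉ p → a ≡ b
  acyclic⇒nbrs-joined-avoiding-equal acyc xa xb stop x∉p = refl
  acyclic⇒nbrs-joined-avoiding-equal acyc {x} {b = b} xa xb P@(step e Q@(step _ _ _) _) x∉p = ⊥-elim (acyc record
    { distinct = path-unique (step xa P x∉p)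
    ; linked   = path-linked (step xa P x∉p)
    ; closing  = λ eq → closes (trans (≡.sym eq) (path-last Q))
    })
    where
    closes : ∀ {y} → just y ≡ just b → Adj G y x
    closes refl = sym G xb
  acyclic⇒nbrs-joined-avoiding-equal acyc {x} {b = b} xa xb P@(step {w = w} e stop _) x∉p = ⊥-elim (acyc record
    { distinct = path-unique (step xa P x∉p)
    ; linked   = path-linked (step xa P x∉p)
    ; closing  = λ { refl → sym G xb }
    })

  -- Building a tree by grafting branches

  -- Rooted v xs: an induced subtree on the vertices xs with root v, built by
  -- hanging one branch after another below the root.
  data Rooted : V → List V → Set where
    leaf  : ∀ v → Rooted v (v ∷ [])
    graft : ∀ {u v xs ys} → Rooted u xs → Rooted v ys → Adj G v u → Disjoint xs ys →
            (∀ {x y} → x ∈ xs → y ∈ ys → Adj G x y → x ≡ u × y ≡ v) → Rooted v (xs ++ ys)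

  root∈ : ∀ {v xs} → Rooted v xs → v ∈ xs
  root∈ (leaf v)                   = here refl
  root∈ (graft {xs = xs} s t _ _ _) = ∈-++⁺ʳ xs (root∈ t)

  path-between : ∀ {v xs} → Rooted v xs → ∀ {a b} → a ∈ xs → b ∈ xs → ∃ λ p → Path a b p × p ⊆ xs
  path-between (leaf v) (here refl) (here refl) = _ , stop , λ x∈ → x∈
  path-between (graft {xs = xs} {ys} s t vu xs#ys _) a∈ b∈ with ∈-++⁻ xs a∈ | ∈-++⁻ xs b∈
  ... | inj₁ a∈xs | inj₁ b∈xs with p , P , p⊆ ← path-between s a∈xs b∈xs = p , P , ∈-++⁺ˡ ∘ p⊆
  ... | inj₂ a∈ys | inj₂ b∈ys with p , P , p⊆ ← path-between t a∈ys b∈ys = p , P , ∈-++⁺ʳ xs ∘ p⊆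
  ... | inj₁ a∈xs | inj₂ b∈ys
      with p , P , p⊆ ← path-between s a∈xs (root∈ s) | q , Q , q⊆ ← path-between t (root∈ t) b∈ys
      = p ++ q , join P (sym G vu) Q (λ (x∈p , x∈q) → xs#ys (p⊆ x∈p , q⊆ x∈q))
      , λ x∈ → [ (λ x∈p → ∈-++⁺ˡ (p⊆ x∈p)) , (λ x∈q → ∈-++⁺ʳ xs (q⊆ x∈q)) ]′ (∈-++⁻ p x∈)
  ... | inj₂ a∈ys | inj₁ b∈xs
      with p , P , p⊆ ← path-between t a∈ys (root∈ t) | q , Q , q⊆ ← path-between s (root∈ s) b∈xs
      = p ++ q , join P vu Q (λ (x∈p , x∈q) → xs#ys (q⊆ x∈q , p⊆ x∈p))
      , λ x∈ → [ (λ x∈p → ∈-++⁺ʳ xs (p⊆ x∈p)) , (λ x∈q → ∈-++⁺ˡ (q⊆ x∈q)) ]′ (∈-++⁻ p x∈)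

  -- The recursion enters the side of the last graft that contains `y`. That `x` has no other
  -- neighbour in `xs` keeps the two sides joined by a single edge.
  hang : ∀ {v xs} → Rooted v xs → ∀ {x y} → x ∉ xs → y ∈ xs → Adj G y x → (∀ {z} → z ∈ xs → Adj G x z → z ≡ y) →
         ∃ λ zs → Rooted v zs × xs ⊆ zs × x ∈ zs × (∀ {z} → z ∈ zs → z ≡ x ⊎ z ∈ xs)
  hang (leaf v) {x} x∉ (here refl) yx only =
    x ∷ v ∷ [] ,
    graft (leaf x) (leaf v) yx (λ { (here refl , x∈) → x∉ x∈ }) (λ { (here refl) (here refl) _ → refl , refl }) ,
    there , here refl , λ { (here eq) → inj₁ eq ; (there z∈) → inj₂ z∈ }
  hang (graft {u} {v} {xs} {ys} s t vu xs#ys sep) {x} {y} x∉ y∈ yx only with ∈-++⁻ xs y∈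
  ... | inj₂ y∈ys
      with zs , t′ , ys⊆zs , x∈zs , zs⊆ ← hang t (x∉ ∘ ∈-++⁺ʳ xs) y∈ys yx (only ∘ ∈-++⁺ʳ xs)
      = xs ++ zs , graft s t′ vu dis sep′ ,
        (λ z∈ → [ ∈-++⁺ˡ , (λ z∈ys → ∈-++⁺ʳ xs (ys⊆zs z∈ys)) ]′ (∈-++⁻ xs z∈)) ,
        ∈-++⁺ʳ xs x∈zs ,
        (λ z∈ → [ inj₂ ∘ ∈-++⁺ˡ , (λ z∈zs → map₂ (∈-++⁺ʳ xs) (zs⊆ z∈zs)) ]′ (∈-++⁻ xs z∈))
    where
    dis : Disjoint xs zs
    dis (z∈xs , z∈zs) with zs⊆ z∈zs
    ... | inj₁ refl = x∉ (∈-++⁺ˡ z∈xs)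
    ... | inj₂ z∈ys = xs#ys (z∈xs , z∈ys)
    sep′ : ∀ {a b} → a ∈ xs → b ∈ zs → Adj G a b → a ≡ u × b ≡ v
    sep′ a∈ b∈ ab with zs⊆ b∈
    ... | inj₂ b∈ys = sep a∈ b∈ys ab
    -- A neighbour of the new vertex in `xs` would have to be `y`, but `y` lies in `ys`.
    ... | inj₁ refl with refl ← only (∈-++⁺ˡ a∈) (sym G ab) = ⊥-elim (xs#ys (a∈ , y∈ys))
  ... | inj₁ y∈xs
      with zs , s′ , xs⊆zs , x∈zs , zs⊆ ← hang s (x∉ ∘ ∈-++⁺ˡ) y∈xs yx (only ∘ ∈-++⁺ˡ)
      = zs ++ ys , graft s′ t vu dis sep′ ,
        (λ z∈ → [ ∈-++⁺ˡ ∘ xs⊆zs , ∈-++⁺ʳ zs ]′ (∈-++⁻ xs z∈)) ,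
        ∈-++⁺ˡ x∈zs ,
        (λ z∈ → [ (λ z∈zs → map₂ ∈-++⁺ˡ (zs⊆ z∈zs)) , inj₂ ∘ ∈-++⁺ʳ xs ]′ (∈-++⁻ zs z∈))
    where
    dis : Disjoint zs ys
    dis (z∈zs , z∈ys) with zs⊆ z∈zs
    ... | inj₁ refl = x∉ (∈-++⁺ʳ xs z∈ys)
    ... | inj₂ z∈xs = xs#ys (z∈xs , z∈ys)
    sep′ : ∀ {a b} → a ∈ zs → b ∈ ys → Adj G a b → a ≡ u × b ≡ v
    sep′ a∈ b∈ ab with zs⊆ a∈
    ... | inj₂ a∈xs = sep a∈xs b∈ ab
    ... | inj₁ refl with refl ← only (∈-++⁺ʳ xs b∈) ab = ⊥-elim (xs#ys (y∈xs , b∈))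

  module _ (acyc : Acyclic G) where

    absorb : ∀ {v xs a z} → Rooted v xs → a ∈ xs → Walk G a z → ∃ λ ys → Rooted v ys × xs ⊆ ys × z ∈ ys
    absorb t a∈ here = _ , t , (λ x∈ → x∈) , a∈
    absorb {xs = xs} t a∈ (step {w = w} aw walk) with w ∈? xs
    ... | yes w∈ = absorb t w∈ walk
    ... | no  w∉
        with ys , t′ , xs⊆ys , w∈ys , _ ← hang t w∉ a∈ aw
               -- Any neighbour of `w` in the subtree is joined to `a` inside it, hence avoiding
               -- `w`, so acyclicity identifies the two.
               (λ z∈ wz → let _ , P , p⊆ = path-between t z∈ a∈ in
                  acyclic⇒nbrs-joined-avoiding-equal acyc wz (sym G aw) P (w∉ ∘ p⊆))
        with zs , t″ , ys⊆zs , z∈zs ← absorb t′ w∈ys walk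
        = zs , t″ , ys⊆zs ∘ xs⊆ys , z∈zs

    absorbAll : Connected G → ∀ {v xs} → Rooted v xs → (zs : List V) →
                ∃ λ ys → Rooted v ys × xs ⊆ ys × zs ⊆ ys
    absorbAll conn t []       = _ , t , (λ x∈ → x∈) , λ ()
    absorbAll conn {v} t (z ∷ zs)
      with ys , t′ , xs⊆ys , z∈ys ← absorb t (root∈ t) (conn v z)
      with us , t″ , ys⊆us , zs⊆us ← absorbAll conn t′ zs
      = us , t″ , ys⊆us ∘ xs⊆ys , λ { (here refl) → ys⊆us z∈ys ; (there y∈) → zs⊆us y∈ }

  tree⇒rooted : IsTree G → (v : V) → ∃ λ xs → Rooted v xs × (∀ x → x ∈ xs)
  tree⇒rooted (conn , acyc) v with xs , t , _ , all∈ ← absorbAll acyc conn (leaf v) (allFin n)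
    = xs , t , λ x → all∈ (∈-allFin x)

  -- The set `D` and the free set of witnesses

  -- selected: the root lies in D; dominated: it has a child in D.
  selected dominated : ∀ {v xs} → Rooted v xs → Bool
  selected (leaf v)           = false
  selected (graft s t _ _ _)  = not (dominated s) ∨ selected t
  dominated (leaf v)          = false
  dominated (graft s t _ _ _) = selected s ∨ dominated t

  -- The choice at the root is provisional: a later branch with undominated root replaces it. It is
  -- therefore kept apart from `below`, which collects the final choices made at proper descendants.
  witness : ∀ {v xs} → Rooted v xs → List V
  witness (leaf v)              = []
  witness (graft {u} s t _ _ _) = if dominated s then witness t else u ∷ []

  below : ∀ {v xs} → Rooted v xs → List V
  below (leaf v)          = []
  below (graft s t _ _ _) = (witness s ++ below s) ++ below t

  packing : ∀ {v xs} → Rooted v xs → List V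
  packing t = witness t ++ below t

  witness-length : ∀ {v xs} (t : Rooted v xs) → length (witness t) ≡ (if selected t then 1 else 0)
  witness-length (leaf v) = refl
  witness-length (graft s t _ _ _) with dominated s
  ... | true  = witness-length t
  ... | false = refl

  unselected⇒no-witness : ∀ {v xs} (t : Rooted v xs) → selected t ≡ false → witness t ≡ []
  unselected⇒no-witness (leaf v) _ = refl
  unselected⇒no-witness (graft s t _ _ _) eq with dominated s
  ... | true = unselected⇒no-witness t eq

  witness-unique : ∀ {v xs a b} (t : Rooted v xs) → a ∈ witness t → b ∈ witness t → a ≡ b
  witness-unique (graft s t _ _ _) a∈ b∈ with dominated s
  ... | true = witness-unique t a∈ b∈
  witness-unique (graft s t _ _ _) (here refl) (here refl) | false = refl

  witness⊆ : ∀ {v xs} (t : Rooted v xs) → witness t ⊆ xs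
  witness⊆ (graft {xs = xs} s t _ _ _) a∈ with dominated s
  ... | true = ∈-++⁺ʳ xs (witness⊆ t a∈)
  witness⊆ (graft s t _ _ _) (here refl) | false = ∈-++⁺ˡ (root∈ s)

  below⊆ : ∀ {v xs} (t : Rooted v xs) → below t ⊆ xs
  packing⊆ : ∀ {v xs} (t : Rooted v xs) → packing t ⊆ xs
  below⊆ (graft {xs = xs} s t _ _ _) a∈ with ∈-++⁻ (packing s) a∈
  ... | inj₂ a∈t = ∈-++⁺ʳ xs (below⊆ t a∈t)
  ... | inj₁ a∈s with ∈-++⁻ (witness s) a∈s
  ...   | inj₁ a∈w = ∈-++⁺ˡ (witness⊆ s a∈w)
  ...   | inj₂ a∈b = ∈-++⁺ˡ (below⊆ s a∈b)
  packing⊆ t a∈ with ∈-++⁻ (witness t) a∈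
  ... | inj₁ a∈w = witness⊆ t a∈w
  ... | inj₂ a∈b = below⊆ t a∈b

  root∉witness : ∀ {v xs} (t : Rooted v xs) → v ∉ witness t
  root∉witness (graft s t _ _ _) v∈ with dominated s
  ... | true = root∉witness t v∈
  root∉witness (graft s t _ xs#ys _) (here refl) | false = xs#ys (root∈ s , root∈ t)

  root∉below : ∀ {v xs} (t : Rooted v xs) → v ∉ below t
  root∉below (graft s t _ xs#ys _) v∈ with ∈-++⁻ (packing s) v∈
  ... | inj₁ v∈s = xs#ys (packing⊆ s v∈s , root∈ t)
  ... | inj₂ v∈t = root∉below t v∈t

  root∉packing : ∀ {v xs} (t : Rooted v xs) → v ∉ packing t
  root∉packing t v∈ with ∈-++⁻ (witness t) v∈
  ... | inj₁ v∈w = root∉witness t v∈w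
  ... | inj₂ v∈b = root∉below t v∈b

  -- Children chosen by proper descendants of the root lie at depth at least two.
  root-nbr∉below : ∀ {v xs a} (t : Rooted v xs) → Adj G v a → a ∉ below t
  root-nbr∉below (graft s t _ _ sep) va a∈ with ∈-++⁻ (packing s) a∈
  ... | inj₂ a∈t = root-nbr∉below t va a∈t
  ... | inj₁ a∈s with refl , _ ← sep (packing⊆ s a∈s) (root∈ t) (sym G va) = root∉packing s a∈s

  witness#below : ∀ {v xs} (t : Rooted v xs) → Disjoint (witness t) (below t)
  witness#below (graft s t _ xs#ys _) (a∈w , a∈b) with dominated s | ∈-++⁻ (packing s) a∈b
  ... | true | inj₁ a∈s = xs#ys (packing⊆ s a∈s , witness⊆ t a∈w)
  ... | true | inj₂ a∈t = witness#below t (a∈w , a∈t)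
  witness#below (graft s t _ xs#ys _) (here refl , _) | false | inj₁ a∈s = root∉packing s a∈s
  witness#below (graft s t _ xs#ys _) (here refl , _) | false | inj₂ a∈t = xs#ys (root∈ s , below⊆ t a∈t)

  witness! : ∀ {v xs} (t : Rooted v xs) → Unique (witness t)
  witness! (leaf v) = []
  witness! (graft s t _ _ _) with dominated s
  ... | true  = witness! t
  ... | false = [] ∷ []

  below! : ∀ {v xs} (t : Rooted v xs) → Unique (below t)
  packing! : ∀ {v xs} (t : Rooted v xs) → Unique (packing t)
  below! (leaf v) = []
  below! (graft s t _ xs#ys _) =
    Unique.++⁺ (Unique.++⁺ (witness! s) (below! s) (witness#below s)) (below! t)
      (λ (a∈s , a∈t) → xs#ys (packing⊆ s a∈s , below⊆ t a∈t))
  packing! t = Unique.++⁺ (witness! t) (below! t) (witness#below t)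

  -- The last clause says that the root may be added to the packing when it has no child in D.
  Packs : ∀ {v xs} → Rooted v xs → Set
  Packs {v} {xs} t =
    (∀ {x a b} → x ∈ xs → Adj G x a → Adj G x b → a ∈ below t → b ∈ below t → a ≡ b) ×
    (∀ {x a b} → x ∈ xs → Adj G x a → Adj G x b → a ∈ witness t → b ∉ below t) ×
    (dominated t ≡ false → ∀ {x b} → x ∈ xs → Adj G x v → Adj G x b → b ∉ packing t)

  packs⇒atMostOne : ∀ {v xs} (t : Rooted v xs) → Packs t → ∀ {x} → x ∈ xs → AtMostOneNbrInList (packing t) x
  packs⇒atMostOne t (bb , wb , _) x∈ xa xb a∈ b∈ with ∈-++⁻ (witness t) a∈ | ∈-++⁻ (witness t) b∈
  ... | inj₁ a∈w | inj₁ b∈w = witness-unique t a∈w b∈w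
  ... | inj₁ a∈w | inj₂ b∈b = ⊥-elim (wb x∈ xa xb a∈w b∈b)
  ... | inj₂ a∈b | inj₁ b∈w = ⊥-elim (wb x∈ xb xa b∈w a∈b)
  ... | inj₂ a∈b | inj₂ b∈b = bb x∈ xa xb a∈b b∈b

  -- The clauses need a joint induction: a new witness `u` is compatible with `packing s` by the
  -- third clause for `s`.
  packs : ∀ {v xs} (t : Rooted v xs) → Packs t
  packs (leaf v) = (λ _ _ _ ()) , (λ _ _ _ ()) , λ _ _ _ _ ()
  packs (graft {u} {v} {xs} {ys} s t vu xs#ys sep) = bb , wb , rb
    where
    IHs = packs s
    IHt = packs t

    -- Only the edge `vu` joins the two sides and no packing contains its own root, so neither
    -- packing is seen from across.
    no-s : ∀ {x a} → x ∈ ys → Adj G x a → a ∉ packing s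
    no-s x∈ xa a∈ with refl , _ ← sep (packing⊆ s a∈) x∈ (sym G xa) = root∉packing s a∈

    no-t : ∀ {x a} → x ∈ xs → Adj G x a → a ∉ packing t
    no-t x∈ xa a∈ with _ , refl ← sep x∈ (packing⊆ t a∈) xa = root∉packing t a∈

    bb : ∀ {x a b} → x ∈ xs ++ ys → Adj G x a → Adj G x b →
         a ∈ packing s ++ below t → b ∈ packing s ++ below t → a ≡ b
    bb x∈ xa xb a∈ b∈ with ∈-++⁻ xs x∈ | ∈-++⁻ (packing s) a∈ | ∈-++⁻ (packing s) b∈
    ... | inj₁ x∈s | inj₁ a∈s | inj₁ b∈s = packs⇒atMostOne s IHs x∈s xa xb a∈s b∈s
    ... | inj₁ x∈s | inj₂ a∈t | _        = ⊥-elim (no-t x∈s xa (∈-++⁺ʳ (witness t) a∈t))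
    ... | inj₁ x∈s | _        | inj₂ b∈t = ⊥-elim (no-t x∈s xb (∈-++⁺ʳ (witness t) b∈t))
    ... | inj₂ x∈t | inj₁ a∈s | _        = ⊥-elim (no-s x∈t xa a∈s)
    ... | inj₂ x∈t | _        | inj₁ b∈s = ⊥-elim (no-s x∈t xb b∈s)
    ... | inj₂ x∈t | inj₂ a∈t | inj₂ b∈t = proj₁ IHt x∈t xa xb a∈t b∈t

    wb : ∀ {x a b} → x ∈ xs ++ ys → Adj G x a → Adj G x b →
         a ∈ witness (graft s t vu xs#ys sep) → b ∉ packing s ++ below t
    wb x∈ xa xb a∈ b∈ with ∈-++⁻ xs x∈ | dominated s in eq | ∈-++⁻ (packing s) b∈
    ... | inj₁ x∈s | _     | inj₂ b∈t = no-t x∈s xb (∈-++⁺ʳ (witness t) b∈t)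
    ... | inj₂ x∈t | _     | inj₁ b∈s = no-s x∈t xb b∈s
    ... | inj₁ x∈s | true  | inj₁ b∈s = no-t x∈s xa (∈-++⁺ˡ a∈)
    ... | inj₂ x∈t | true  | inj₂ b∈t = proj₁ (proj₂ IHt) x∈t xa xb a∈ b∈t
    wb x∈ xa xb (here refl) b∈ | inj₁ x∈s | false | inj₁ b∈s = proj₂ (proj₂ IHs) eq x∈s xa xb b∈s
    wb x∈ xa xb (here refl) b∈ | inj₂ x∈t | false | inj₂ b∈t
      with _ , refl ← sep (root∈ s) x∈t (sym G xa) = root-nbr∉below t xb b∈t

    rb : selected s ∨ dominated t ≡ false → ∀ {x b} → x ∈ xs ++ ys → Adj G x v → Adj G x b →
         b ∉ packing (graft s t vu xs#ys sep)
    rb eq x∈ xv xb b∈ with selected s in sel-s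
    ... | false with ∈-++⁻ (witness (graft s t vu xs#ys sep)) b∈ | ∈-++⁻ xs x∈
    ...   | inj₂ b∈b | _ with ∈-++⁻ (packing s) b∈b
    rb eq x∈ xv xb b∈ | false | inj₂ b∈b | inj₁ x∈s | inj₂ b∈t = no-t x∈s xb (∈-++⁺ʳ (witness t) b∈t)
    rb eq x∈ xv xb b∈ | false | inj₂ b∈b | inj₂ x∈t | inj₁ b∈s = no-s x∈t xb b∈s
    rb eq x∈ xv xb b∈ | false | inj₂ b∈b | inj₂ x∈t | inj₂ b∈t = proj₂ (proj₂ IHt) eq x∈t xv xb (∈-++⁺ʳ (witness t) b∈t)
    -- Here `x` is `u`. As `s` is unselected it has no witness, so `b` would be a neighbour of `u`
    -- in `below s`.
    rb eq x∈ xv xb b∈ | false | inj₂ b∈b | inj₁ x∈s | inj₁ b∈s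
      with refl , _ ← sep x∈s (root∈ t) xv
      = root-nbr∉below s xb (subst (λ w → _ ∈ w ++ below s) (unselected⇒no-witness s sel-s) b∈s)
    rb eq x∈ xv xb b∈ | false | inj₁ b∈w | x∈′ with dominated s | x∈′
    ... | true  | inj₁ x∈s = no-t x∈s xb (∈-++⁺ˡ b∈w)
    ... | true  | inj₂ x∈t = proj₂ (proj₂ IHt) eq x∈t xv xb (∈-++⁺ˡ b∈w)
    rb eq x∈ xv xb b∈ | false | inj₁ (here refl) | _ | false | inj₁ x∈s
      with refl , _ ← sep x∈s (root∈ t) xv = irrefl G xb
    rb eq x∈ xv xb b∈ | false | inj₁ (here refl) | _ | false | inj₂ x∈t
      with _ , refl ← sep (root∈ s) x∈t (sym G xb) = irrefl G xv

  fromList-free : ∀ {A} → (∀ x → AtMostOneNbrInList A x) → Free G (fromList A)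
  fromList-free {A} free x a b xa xb a∈ b∈ = free x xa xb (∈-fromList⁻ A a∈) (∈-fromList⁻ A b∈)

  -- Hulls of disjoint parts of an anti-Radon multi-set

  module _ (R : List V) (anti : AntiRadon2 G R) where

    -- Isolating one of two occurrences of a vertex in its own part would put that vertex into both
    -- hulls.
    lookup-injective : ∀ {i j} → lookup R i ≡ lookup R j → i ≡ j
    lookup-injective {i} {j} eq with i ≟ j
    ... | yes i≡j = i≡j
    ... | no  i≢j = ⊥-elim (anti (λ k → does (k ≟ i)) (lookup R i ,
      (λ U _ R₁⊆U → R₁⊆U _ (i , dec-true (i ≟ i) refl , refl)) ,
      (λ U _ R₂⊆U → R₂⊆U _ (j , dec-false (j ≟ i) (i≢j ∘ ≡.sym) , ≡.sym eq))))

    Hull : List V → V → Set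
    Hull S = InHull G (λ x → x ∈ R × x ∈ S)

    hull-mono : ∀ {S S′ v} → S ⊆ S′ → Hull S v → Hull S′ v
    hull-mono S⊆S′ h U convex S′⊆U = h U convex λ x (x∈R , x∈S) → S′⊆U x (x∈R , S⊆S′ x∈S)

    hull-self : ∀ {S v} → v ∈ R → v ∈ S → Hull S v
    hull-self v∈R v∈S U _ S⊆U = S⊆U _ (v∈R , v∈S)

    -- Positions are coloured by membership in `S`. Those in neither set join the second part, which
    -- only enlarges its hull.
    hull-disjoint : ∀ {S S′ v} → Disjoint S S′ → Hull S v → ¬ Hull S′ v
    hull-disjoint {S} {S′} S#S′ h h′ = anti (λ i → does (lookup R i ∈? S)) (_ ,
      (λ U convex R₁⊆U → h U convex λ x (x∈R , x∈S) → R₁⊆U x (index x∈R ,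
        dec-true (_ ∈? S) (subst (_∈ S) (lookup-index x∈R) x∈S) , ≡.sym (lookup-index x∈R))) ,
      (λ U convex R₂⊆U → h′ U convex λ x (x∈R , x∈S′) → R₂⊆U x (index x∈R ,
        dec-false (_ ∈? S) (λ x∈S → S#S′ (x∈S , subst (_∈ S′) (lookup-index x∈R) x∈S′)) , ≡.sym (lookup-index x∈R))))

    -- A supply of v is a set of vertices whose share of R generates a neighbour of v.
    Supply : V → List V → Set
    Supply v xs = ∃ λ u → Adj G v u × u ∈ xs × Hull xs u

    -- The two generated neighbours are distinct because each lies in its own set, so a convex set
    -- containing both contains `v`.
    two-supplies : ∀ {v xs ys} → Supply v xs → Supply v ys → Disjoint xs ys → Hull (xs ++ ys) v
    two-supplies {v} {xs} (u , vu , u∈xs , hu) (w , vw , w∈ys , hw) xs#ys U convex S⊆U with v ∈ₛ? U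
    ... | yes v∈U = v∈U
    ... | no  v∉U with refl ← convex v v∉U u w vu vw
                       (hu U convex λ x (x∈R , x∈xs) → S⊆U x (x∈R , ∈-++⁺ˡ x∈xs))
                       (hw U convex λ x (x∈R , x∈ys) → S⊆U x (x∈R , ∈-++⁺ʳ xs x∈ys))
      = ⊥-elim (xs#ys (u∈xs , w∈ys))

    disjoint-++ˡ : ∀ {xs ys zs : List V} → Disjoint xs zs → Disjoint ys zs → Disjoint (xs ++ ys) zs
    disjoint-++ˡ {xs} xs#zs ys#zs (x∈ , x∈zs) with ∈-++⁻ xs x∈
    ... | inj₁ x∈xs = xs#zs (x∈xs , x∈zs)
    ... | inj₂ x∈ys = ys#zs (x∈ys , x∈zs)

    swap : ∀ {xs ys : List V} → Disjoint xs ys → Disjoint ys xs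
    swap xs#ys (x∈ys , x∈xs) = xs#ys (x∈xs , x∈ys)

    four-supplies : ∀ {v ws xs ys zs} → Supply v ws → Supply v xs → Supply v ys → Supply v zs →
                    AllPairs Disjoint (ws ∷ xs ∷ ys ∷ zs ∷ []) → ⊥
    four-supplies sw sx sy sz ((w#x ∷ w#y ∷ w#z ∷ []) ∷ (x#y ∷ x#z ∷ []) ∷ (y#z ∷ []) ∷ _) =
      hull-disjoint (disjoint-++ˡ (swap (disjoint-++ˡ (swap w#y) (swap w#z))) (swap (disjoint-++ˡ (swap x#y) (swap x#z))))
        (two-supplies sw sx w#x) (two-supplies sy sz y#z)

    -- Keeping `v` out of every set leaves `v` available as a separate part when it belongs to `R`.
    Supplies : V → List V → List (List V) → Set
    Supplies v ys xss = All (λ xs → Supply v xs × xs ⊆ ys × v ∉ xs) xss × AllPairs Disjoint xss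

    -- `Hull xs v` would imply this by `hull-disjoint`; in `full` and `tight`, however, only a
    -- neighbour of the blocked vertex is known to be generated.
    Blocks : List V → V → Set
    Blocks xs v = ∀ {S} → Disjoint S xs → ¬ Hull S v

    -- Bounds for branches, and passing from forest to branch

    -- For a branch with root u and vertices xs, μ counts its vertices in R and
    -- ν is twice the number of its vertices in D.
    data BranchBound (u : V) (xs : List V) (μ ν : ℕ) : Bool → Bool → Set where
      idle  : ∀ {d} → μ ≤ ν → BranchBound u xs μ ν false d
      spare : μ ≤ suc ν → Hull xs u → BranchBound u xs μ ν false false
      low   : ∀ {d} → suc μ ≤ ν → BranchBound u xs μ ν true d
      even  : μ ≤ ν → Hull xs u → BranchBound u xs μ ν true false
      full  : μ ≤ suc ν → Hull xs u → (∀ {p} → p ∉ xs → Adj G u p → Blocks xs p) → BranchBound u xs μ ν true false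
      tight : μ ≤ ν → Hull xs u → (∀ {p} → p ∉ xs → Adj G u p → Blocks xs p) → BranchBound u xs μ ν true true

    -- The same counts for the branches below v together; s and d tell
    -- whether v lies in D and whether v has a child in D.
    -- dom and unselDom: a child of v in D either blocks v or has a deficit.
    record ForestBound (v : V) (ys : List V) (m β : ℕ) (s d : Bool) : Set where
      field
        supplied : ∃ λ xss → Supplies v ys xss × m ≤ length xss + β
        unsel    : s ≡ false → m ≤ β
        dom      : d ≡ true →
          (∃ λ zs → ∃ λ xss → Supplies v ys (zs ∷ xss) × Blocks zs v × m ≤ suc (length xss) + β) ⊎
          (∃ λ xss → Supplies v ys xss × suc m ≤ length xss + β)
        unselDom : s ≡ false → d ≡ true → (∃ λ zs → v ∉ zs × Blocks zs v) ⊎ suc m ≤ β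

    open ForestBound

    weight : ∀ {v} → Dec (v ∈ R) → ℕ
    weight v∈R? = if does v∈R? then 1 else 0

    cost : Bool → ℕ
    cost s = if s then 2 else 0

    singleton# : ∀ {v : V} {xs} → v ∉ xs → Disjoint (v ∷ []) xs
    singleton# v∉ (here refl , v∈) = v∉ v∈

    -- `Supply` asks for the generated neighbour to be a member, so `p` is put into the set.
    outside : ∀ {v p S zs} → Adj G v p → p ∉ zs → Disjoint S zs → Hull S p → Supply v (p ∷ S) × Disjoint (p ∷ S) zs
    outside vp p∉ S#zs h = (_ , vp , here refl , hull-mono there h) ,
      λ { (here refl , p∈) → p∉ p∈ ; (there x∈S , x∈zs) → S#zs (x∈S , x∈zs) }

    module _ {v : V} {ys : List V} where

      hull-two : ∀ {xs zs xss} → Supplies v ys (xs ∷ zs ∷ xss) → Hull (xs ++ zs) v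
      hull-two ((sx , _) ∷ (sz , _) ∷ _ , (x#z ∷ _) ∷ _) = two-supplies sx sz x#z

      hull-two-all : ∀ {xs zs xss} → Supplies v ys (xs ∷ zs ∷ xss) → Hull ys v
      hull-two-all {xs} S@((_ , xs⊆ , _) ∷ (_ , zs⊆ , _) ∷ _ , _) = hull-mono
        (λ x∈ → [ xs⊆ , zs⊆ ]′ (∈-++⁻ xs x∈)) (hull-two S)

      no-two-at-R : v ∈ R → ∀ {xs zs xss} → ¬ Supplies v ys (xs ∷ zs ∷ xss)
      no-two-at-R v∈R {xs} S@((_ , _ , v∉xs) ∷ (_ , _ , v∉zs) ∷ _ , _) = hull-disjoint
        (singleton# (λ v∈ → [ v∉xs , v∉zs ]′ (∈-++⁻ xs v∈))) (hull-self v∈R (here refl)) (hull-two S)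

      no-four : ∀ {ws xs zs us xss} → ¬ Supplies v ys (ws ∷ xs ∷ zs ∷ us ∷ xss)
      no-four ((s₁ , _) ∷ (s₂ , _) ∷ (s₃ , _) ∷ (s₄ , _) ∷ _ ,
               (a ∷ b ∷ c ∷ _) ∷ (d ∷ e ∷ _) ∷ (f ∷ _) ∷ _) =
        four-supplies s₁ s₂ s₃ s₄ ((a ∷ b ∷ c ∷ []) ∷ (d ∷ e ∷ []) ∷ (f ∷ []) ∷ [] ∷ [])

      -- Were `p` generated from outside `ys`, it would provide a fourth supply.
      three-block : ∀ {ws xs zs xss} → Supplies v ys (ws ∷ xs ∷ zs ∷ xss) → ∀ {p} → p ∉ ys → Adj G v p → Blocks ys p
      three-block ((s₁ , ⊆₁ , _) ∷ (s₂ , ⊆₂ , _) ∷ (s₃ , ⊆₃ , _) ∷ _ , (a ∷ b ∷ _) ∷ (c ∷ _) ∷ _) p∉ vp S#ys h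
        with sp , p# ← outside vp p∉ S#ys h
        = four-supplies sp s₁ s₂ s₃
            (((λ (x , y) → p# (x , ⊆₁ y)) ∷ (λ (x , y) → p# (x , ⊆₂ y)) ∷ (λ (x , y) → p# (x , ⊆₃ y)) ∷ []) ∷
             (a ∷ b ∷ []) ∷ (c ∷ []) ∷ [] ∷ [])

      blocked-pair : ∀ {zs us ws xss} → Blocks zs v → ¬ Supplies v ys (zs ∷ us ∷ ws ∷ xss)
      blocked-pair block (_ ∷ (s₁ , _) ∷ (s₂ , _) ∷ _ , (a ∷ b ∷ _) ∷ (c ∷ _) ∷ _) =
        block (disjoint-++ˡ (swap a) (swap b)) (two-supplies s₁ s₂ c)

      -- Were `p` generated from outside `ys`, then `p` and the supply `us` would generate `v`
      -- without `zs`.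
      blocked-outside : ∀ {zs us xss} → Blocks zs v → Supplies v ys (zs ∷ us ∷ xss) →
                        ∀ {p} → p ∉ ys → Adj G v p → Blocks ys p
      blocked-outside block ((_ , ⊆₁ , _) ∷ (s₂ , ⊆₂ , _) ∷ _ , (a ∷ _) ∷ _) p∉ vp S#ys h
        with sp , p# ← outside vp p∉ S#ys h
        = block (disjoint-++ˡ (λ (x , y) → p# (x , ⊆₁ y)) (swap a))
            (two-supplies sp s₂ (λ (x , y) → p# (x , ⊆₂ y)))

      blocked-at-R : ∀ {zs} → v ∈ R → v ∉ zs → ¬ Blocks zs v
      blocked-at-R v∈R v∉ block = block (singleton# v∉) (hull-self v∈R (here refl))

      -- If `v` is in `D` but has no child there, its cost of two covers two supplies; a third
      -- leaves a surplus of one but blocks the parent, and a fourth is impossible. If moreover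
      -- `v ∈ R`, it uses one unit itself but admits at most one supply.
      branch-bound : ∀ {m β s d} → v ∈ ys → (v∈R? : Dec (v ∈ R)) → ForestBound v ys m β s d →
                     BranchBound v ys (weight v∈R? + m) (cost s + β) s d
      branch-bound {s = false} _ (no _) F = idle (unsel F refl)
      branch-bound {s = false} {false} v∈ys (yes v∈R) F = spare (s≤s (unsel F refl)) (hull-self v∈R v∈ys)
      branch-bound {s = false} {true} v∈ys (yes v∈R) F with unselDom F refl refl
      ... | inj₁ (zs , v∉ , block) = ⊥-elim (blocked-at-R v∈R v∉ block)
      ... | inj₂ le                = idle le
      branch-bound {s = true} {false} _ (no _) F with supplied F
      ... | []                 , S , le = low (s≤s (m≤n⇒m≤1+n le))
      ... | _ ∷ []             , S , le = low (s≤s le)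
      ... | _ ∷ _ ∷ []         , S , le = even le (hull-two-all S)
      ... | _ ∷ _ ∷ _ ∷ []     , S , le = full le (hull-two-all S) (three-block S)
      ... | _ ∷ _ ∷ _ ∷ _ ∷ _  , S , le = ⊥-elim (no-four S)
      branch-bound {s = true} {false} v∈ys (yes v∈R) F with supplied F
      ... | []        , S , le = low (s≤s (s≤s le))
      ... | _ ∷ []    , S , le = even (s≤s le) (hull-self v∈R v∈ys)
      ... | _ ∷ _ ∷ _ , S , le = ⊥-elim (no-two-at-R v∈R S)
      branch-bound {s = true} {true} _ (no _) F with dom F refl
      ... | inj₁ (zs , []        , S , block , le) = low (s≤s le)
      -- The blocking set is itself one of the two supplies, so the cost of two covers both.
      ... | inj₁ (zs , _ ∷ []    , S , block , le) = tight le (hull-two-all S) (blocked-outside block S)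
      ... | inj₁ (zs , _ ∷ _ ∷ _ , S , block , le) = ⊥-elim (blocked-pair block S)
      ... | inj₂ ([]                , S , le) = low (m≤n⇒m≤1+n (m≤n⇒m≤1+n le))
      ... | inj₂ (_ ∷ []            , S , le) = low (m≤n⇒m≤1+n le)
      ... | inj₂ (_ ∷ _ ∷ []        , S , le) = low le
      -- The deficit recorded in `dom` pays for the third supply.
      ... | inj₂ (_ ∷ _ ∷ _ ∷ []    , S , le) = tight (s≤s⁻¹ le) (hull-two-all S) (three-block S)
      ... | inj₂ (_ ∷ _ ∷ _ ∷ _ ∷ _ , S , le) = ⊥-elim (no-four S)
      branch-bound {s = true} {true} v∈ys (yes v∈R) F with dom F refl
      ... | inj₁ (zs , _ , ((_ , _ , v∉) ∷ _ , _) , block , _) = ⊥-elim (blocked-at-R v∈R v∉ block)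
      ... | inj₂ ([]        , S , le) = low (s≤s (m≤n⇒m≤1+n le))
      ... | inj₂ (_ ∷ []    , S , le) = low (s≤s le)
      ... | inj₂ (_ ∷ _ ∷ _ , S , le) = ⊥-elim (no-two-at-R v∈R S)

    -- Grafting a branch onto a forest

    +-shift : ∀ i j k l {μ ν m β} → i + μ ≤ k + ν → j + m ≤ l + β → i + j + (μ + m) ≤ k + l + (ν + β)
    +-shift i j k l {μ} {ν} {m} {β} p q =
      subst (_≤ k + l + (ν + β)) (≡.sym (rearrange i j μ m)) (subst (i + μ + (j + m) ≤_) (≡.sym (rearrange k l ν β)) (+-mono-≤ p q))
      where
      rearrange : ∀ a b c d → a + b + (c + d) ≡ a + c + (b + d)
      rearrange = solve-∀

    module _ {u v : V} {xs ys : List V} (u∈xs : u ∈ xs) (v∈ys : v ∈ ys) (vu : Adj G v u) (xs#ys : Disjoint xs ys) where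

      private
        v∉xs : v ∉ xs
        v∉xs v∈xs = xs#ys (v∈xs , v∈ys)

      keep : ∀ {xss} → Supplies v ys xss → Supplies v (xs ++ ys) xss
      keep (S , D) = All.map widen S , D
        where
        widen : ∀ {zs} → Supply v zs × zs ⊆ ys × v ∉ zs → Supply v zs × zs ⊆ xs ++ ys × v ∉ zs
        widen (s , zs⊆ , v∉) = s , (λ z∈ → ∈-++⁺ʳ xs (zs⊆ z∈)) , v∉

      add : ∀ {xss} → Hull xs u → Supplies v ys xss → Supplies v (xs ++ ys) (xs ∷ xss)
      add h (S , D) = ((u , vu , u∈xs , h) , ∈-++⁺ˡ , v∉xs) ∷ proj₁ (keep (S , D)) ,
        All.map apart S ∷ D
        where
        apart : ∀ {zs} → Supply v zs × zs ⊆ ys × v ∉ zs → Disjoint xs zs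
        apart (_ , zs⊆ , _) (z∈xs , z∈zs) = xs#ys (z∈xs , zs⊆ z∈zs)

      -- `dom` expects the blocking set at the head of the list.
      add-second : ∀ {zs xss} → Hull xs u → Supplies v ys (zs ∷ xss) → Supplies v (xs ++ ys) (zs ∷ xs ∷ xss)
      add-second h S with add h S
      ... | x ∷ z ∷ r , (x#z ∷ x#r) ∷ z#r ∷ D = z ∷ x ∷ r , (swap x#z ∷ z#r) ∷ x#r ∷ D

      forest-bound : ∀ {μ ν m β s d s′ d′} → BranchBound u xs μ ν s d → ForestBound v ys m β s′ d′ →
                     ForestBound v (xs ++ ys) (μ + m) (ν + β) (not d ∨ s′) (s ∨ d′)
      forest-bound B F .supplied with xss , S , le ← supplied F = go B
        where
        go : ∀ {s d} → BranchBound u xs _ _ s d → _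
        go (idle p)        = xss , keep S , +-shift 0 0 0 (length xss) p le
        -- A surplus of one, the `1` given to `+-shift`, is matched by listing the branch as a
        -- further supply.
        go (spare p h)     = xs ∷ xss , add h S , +-shift 0 0 1 (length xss) p le
        go (low p)         = xss , keep S , +-shift 0 0 0 (length xss) (≤-trans (n≤1+n _) p) le
        go (even p h)      = xss , keep S , +-shift 0 0 0 (length xss) p le
        go (full p h _)    = xs ∷ xss , add h S , +-shift 0 0 1 (length xss) p le
        go (tight p h _)   = xss , keep S , +-shift 0 0 0 (length xss) p le
      -- An unselected root forces `d` to be true, which leaves only constructors without surplus.
      forest-bound {d = true} (idle p)      F .unsel eq = +-mono-≤ p (unsel F eq)
      forest-bound {d = true} (low p)       F .unsel eq = +-mono-≤ (≤-trans (n≤1+n _) p) (unsel F eq)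
      forest-bound {d = true} (tight p _ _) F .unsel eq = +-mono-≤ p (unsel F eq)
      forest-bound (idle p) F .dom eq with dom F eq
      ... | inj₁ (zs , xss , S , block , le) = inj₁ (zs , xss , keep S , block , +-shift 0 0 0 (suc (length xss)) p le)
      ... | inj₂ (xss , S , le)              = inj₂ (xss , keep S , +-shift 0 1 0 (length xss) p le)
      forest-bound (spare p h) F .dom eq with dom F eq
      ... | inj₁ (zs , xss , S , block , le) =
              inj₁ (zs , xs ∷ xss , add-second h S , block , +-shift 0 0 1 (suc (length xss)) p le)
      ... | inj₂ (xss , S , le)              = inj₂ (xs ∷ xss , add h S , +-shift 0 1 1 (length xss) p le)
      forest-bound (low p) F .dom _ with xss , S , le ← supplied F =
        inj₂ (xss , keep S , +-shift 1 0 0 (length xss) p le)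
      -- The branch is a supply without a surplus, which creates the deficit of one.
      forest-bound (even p h) F .dom _ with xss , S , le ← supplied F =
        inj₂ (xs ∷ xss , add h S , s≤s (+-shift 0 0 0 (length xss) p le))
      forest-bound (full p h block) F .dom _ with xss , S , le ← supplied F =
        inj₁ (xs , xss , add h S , block v∉xs (sym G vu) , +-shift 0 0 1 (length xss) p le)
      -- The branch itself is the blocking set; its lack of surplus leaves one spare unit, which is
      -- given away.
      forest-bound (tight p h block) F .dom _ with xss , S , le ← supplied F =
        inj₁ (xs , xss , add h S , block v∉xs (sym G vu) , m≤n⇒m≤1+n (+-shift 0 0 0 (length xss) p le))
      forest-bound {d = true} (idle p) F .unselDom eq eq′ with unselDom F eq eq′
      ... | inj₁ blocked = inj₁ blocked
      ... | inj₂ le      = inj₂ (+-shift 0 1 0 0 p le)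
      forest-bound {d = true} (low p) F .unselDom eq _ = inj₂ (+-mono-≤ p (unsel F eq))
      forest-bound {d = true} (tight p _ block) F .unselDom _ _ = inj₁ (xs , v∉xs , block v∉xs (sym G vu))

    -- Global counts and the conclusion

    countBelow : ∀ {v xs} → Rooted v xs → ℕ
    countBelow (leaf v)              = 0
    countBelow (graft {u} s t _ _ _) = weight (u ∈? R) + countBelow s + countBelow t

    costBelow : ∀ {v xs} → Rooted v xs → ℕ
    costBelow (leaf v)          = 0
    costBelow (graft s t _ _ _) = cost (selected s) + costBelow s + costBelow t

    forest : ∀ {v xs} (t : Rooted v xs) → ForestBound v xs (countBelow t) (costBelow t) (selected t) (dominated t)
    forest (leaf v) = record
      { supplied = [] , ([] , []) , z≤n ; unsel = λ _ → z≤n ; dom = λ () ; unselDom = λ _ () }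
    forest (graft {u} s t vu xs#ys _) =
      forest-bound (root∈ s) (root∈ t) vu xs#ys (branch-bound (root∈ s) (u ∈? R) (forest s)) (forest t)

    branch : ∀ {v xs} (t : Rooted v xs) →
             BranchBound v xs (weight (v ∈? R) + countBelow t) (cost (selected t) + costBelow t) (selected t) (dominated t)
    branch {v} t = branch-bound (root∈ t) (v ∈? R) (forest t)

    -- Each vertex of `D` costs two and contributes one vertex, its witness, to the packing.
    cost-packing : ∀ {v xs} (t : Rooted v xs) → costBelow t ≡ 2 * length (below t) →
                   cost (selected t) + costBelow t ≡ 2 * length (packing t)
    cost-packing t eq rewrite eq | length-++ (witness t) {below t} | witness-length t
                            | *-distribˡ-+ 2 (if selected t then 1 else 0) (length (below t)) with selected t
    ... | true  = refl
    ... | false = refl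

    cost-below : ∀ {v xs} (t : Rooted v xs) → costBelow t ≡ 2 * length (below t)
    cost-below (leaf v) = refl
    cost-below (graft s t _ _ _)
      rewrite cost-packing s (cost-below s) | cost-below t | length-++ (packing s) {below t}
      = ≡.sym (*-distribˡ-+ 2 (length (packing s)) (length (below t)))

    Rsub : List V → List V
    Rsub xs = filter (_∈? R) xs

    length-Rsub : ∀ {v xs} (t : Rooted v xs) → length (Rsub xs) ≡ weight (v ∈? R) + countBelow t
    length-Rsub (leaf v) with does (v ∈? R)
    ... | true  = refl
    ... | false = refl
    length-Rsub {v} (graft {u} {xs = xs} {ys} s t _ _ _)
      rewrite filter-++ (_∈? R) xs ys | length-++ (Rsub xs) {Rsub ys} | length-Rsub s | length-Rsub t
      = rearrange (weight (u ∈? R) + countBelow s) (weight (v ∈? R)) (countBelow t)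
      where
      rearrange : ∀ a b c → a + (b + c) ≡ b + (a + c)
      rearrange = solve-∀

    -- As `R` has no repetitions, its positions inject into the vertices of `xs` lying in `R`.
    length≤count : ∀ {v xs} (t : Rooted v xs) → (∀ x → x ∈ xs) → length R ≤ weight (v ∈? R) + countBelow t
    length≤count {v} {xs} t all∈ = subst (length R ≤_) (length-Rsub t)
      (injective⇒≤ {f = position} λ {i} {j} eq → lookup-injective
        (trans (lookup-index (found i)) (trans (cong (lookup (Rsub xs)) eq) (≡.sym (lookup-index (found j))))))
      where
      found : ∀ i → lookup R i ∈ Rsub xs
      found i = ∈-filter⁺ (_∈? R) (all∈ (lookup R i)) (∈-lookup i)
      position : Fin (length R) → Fin (length (Rsub xs))
      position i = index (found i)

    rooted⇒free : ∀ {v xs} (t : Rooted v xs) → (∀ x → x ∈ xs) →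
                  Σ (Subset n) λ A → Free G A × length R ≤ 2 * ∣ A ∣
    rooted⇒free {v} {xs} t all∈ = choose (branch t) refl
      where
      count≤ = length≤count t all∈
      cost≡  = cost-packing t (cost-below t)

      dominating : weight (v ∈? R) + countBelow t ≤ cost (selected t) + costBelow t →
                   Σ (Subset n) λ A → Free G A × length R ≤ 2 * ∣ A ∣
      dominating le = fromList (packing t) , fromList-free (λ x → packs⇒atMostOne t (packs t) (all∈ x)) ,
        ≤-trans count≤ (≤-trans le (≤-trans (≤-reflexive cost≡) (*-monoʳ-≤ 2 (length≤∣fromList∣ (packing! t)))))

      undominated : weight (v ∈? R) + countBelow t ≤ suc (cost (selected t) + costBelow t) →
                    dominated t ≡ false → Σ (Subset n) λ A → Free G A × length R ≤ 2 * ∣ A ∣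
      undominated le ¬dom = fromList A , fromList-free free , ≤-trans count≤ (≤-trans le bound)
        where
        -- The root adds two to the bound, enough for a surplus of one, and freeness survives by the
        -- third clause of `Packs`.
        A = v ∷ packing t

        free : ∀ x → AtMostOneNbrInList A x
        free x xa xb (here refl) (here refl) = refl
        free x xa xb (here refl) (there b∈)  = ⊥-elim (proj₂ (proj₂ (packs t)) ¬dom (all∈ x) xa xb b∈)
        free x xa xb (there a∈)  (here refl) = ⊥-elim (proj₂ (proj₂ (packs t)) ¬dom (all∈ x) xb xa a∈)
        free x xa xb (there a∈)  (there b∈)  = packs⇒atMostOne t (packs t) (all∈ x) xa xb a∈ b∈

        A! : Unique A
        A! = All.tabulate (λ x∈ v≡x → root∉packing t (subst (_∈ packing t) (≡.sym v≡x) x∈)) ∷ packing! t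

        double-suc : ∀ k → 2 * suc k ≡ suc (suc (2 * k))
        double-suc = solve-∀

        bound : suc (cost (selected t) + costBelow t) ≤ 2 * ∣ fromList A ∣
        bound = ≤-trans (s≤s (≤-reflexive cost≡))
          (≤-trans (n≤1+n _) (≤-trans (≤-reflexive (≡.sym (double-suc _))) (*-monoʳ-≤ 2 (length≤∣fromList∣ A!))))

      -- Generalising the flags allows matching on the constructors; the equation then tells `spare`
      -- and `full` that the root has no child in `D`.
      choose : ∀ {s d} → BranchBound v xs (weight (v ∈? R) + countBelow t) (cost (selected t) + costBelow t) s d →
               dominated t ≡ d → Σ (Subset n) λ A → Free G A × length R ≤ 2 * ∣ A ∣
      choose (idle le)      _    = dominating le
      choose (low le)       _    = dominating (≤-trans (n≤1+n _) le)
      choose (even le _)    _    = dominating le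
      choose (tight le _ _) _    = dominating le
      choose (spare le _)   ¬dom = undominated le ¬dom
      choose (full le _ _)  ¬dom = undominated le ¬dom

theorem2 : ∀ (n : ℕ) (T : Graph n) → IsTree T →
    ∀ (R : List (Fin n)) → AntiRadon2 T R →
    Σ (Subset n) λ A → Free T A × length R ≤ 2 * ∣ A ∣
-- The empty graph has no vertex to serve as root.
theorem2 zero    T tree []      anti = ∅ , (λ ()) , z≤n
theorem2 (suc n) T tree R       anti with _ , t , all∈ ← tree⇒rooted T tree zero = rooted⇒free T R anti t all∈
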